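{- The Fraïssé limit $(\mathbf{F},\preceq_\mathbf{F})$ of the class of finite ordered echeloned spaces has the Ramsey property; equivalently, the class of finite ordered echeloned spaces is a Ramsey class.
   Context: An echeloned space is a pair $(X,\leq_\mathbf{X})$ where $X$ is a non-empty set and $\leq_\mathbf{X}$ is a total preorder on $X^2$ such that for all $x,y,z$: $(x,x)\leq_\mathbf{X}(y,z)$; $(y,z)\leq_\mathbf{X}(x,x)$ implies $y=z$; $(x,y)\leq_\mathbf{X}(y,x)$. An ordered echeloned space additionally carries a linear order $\preceq$ on $X$; it is a relational structure with a $4$-ary relation ($(x_1,y_1)\leq(x_2,y_2)$) and the binary relation $\preceq$, and embeddings/substructures are understood for such relational structures. For structures $\mathbf{A},\mathbf{B}$, $\binom{\mathbf{B}}{\mathbf{A}}$ denotes the set of substructures of $\mathbf{B}$ isomorphic to $\mathbf{A}$. A class $\mathcal{C}$ is a Ramsey class if for all $\mathbf{A},\mathbf{B}\in\mathcal{C}$ and $k\in\mathbb{N}^+$ there is $\mathbf{C}\in\mathcal{C}$ such that for every partition of $\binom{\mathbf{C}}{\mathbf{A}}$ into $k$ classes there is $\tilde{\mathbf{B}}\in\binom{\mathbf{C}}{\mathbf{B}}$ with $\binom{\tilde{\mathbf{B}}}{\mathbf{A}}$ contained in a single class. A countable structure has the Ramsey property if the class of its finite substructures (its age) is a Ramsey class. -}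

module Defs where

open import Data.Nat using (ℕ; _≤_)
open import Data.Bool using (Bool; T)
open import Data.Fin using (Fin)
open import Data.Fin.Subset using (Subset; _∈_; _⊆_)
open import Data.Product using (Σ; ∃; _×_; _,_)
open import Data.Sum using (_⊎_)
open import Function.Definitions using (Injective)
open import Relation.Binary.PropositionalEquality using (_≡_)

-- A finite ordered echeloned space, with carrier Fin size.
-- The 4-ary relation (x,y) ≤ (z,w) is  T (ech x y z w),
-- the linear order x ⪯ y is  T (ord x y).
record OrdEchSpace : Set where
  field
    size : ℕ
    ech  : Fin size → Fin size → Fin size → Fin size → Bool
    ord  : Fin size → Fin size → Bool
    nonempty : 1 ≤ size
    ech-refl  : ∀ x y → T (ech x y x y)
    ech-trans : ∀ x₁ y₁ x₂ y₂ x₃ y₃ →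
                T (ech x₁ y₁ x₂ y₂) → T (ech x₂ y₂ x₃ y₃) → T (ech x₁ y₁ x₃ y₃)
    ech-total : ∀ x₁ y₁ x₂ y₂ → T (ech x₁ y₁ x₂ y₂) ⊎ T (ech x₂ y₂ x₁ y₁)
    ech-diag-min : ∀ x y z → T (ech x x y z)
    ech-diag-only : ∀ x y z → T (ech y z x x) → y ≡ z
    ech-sym : ∀ x y → T (ech x y y x)
    ord-refl    : ∀ x → T (ord x x)
    ord-antisym : ∀ x y → T (ord x y) → T (ord y x) → x ≡ y
    ord-trans   : ∀ x y z → T (ord x y) → T (ord y z) → T (ord x z)
    ord-total   : ∀ x y → T (ord x y) ⊎ T (ord y x)

open OrdEchSpace public

IsCopy : (A C : OrdEchSpace) → Subset (size C) → Set
IsCopy A C S =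
  Σ (Fin (size A) → Fin (size C)) λ f →
      Injective _≡_ _≡_ f
    × (∀ j → (j ∈ S → ∃ λ i → f i ≡ j) × (∀ i → f i ≡ j → j ∈ S))
    × (∀ a b c d → ech A a b c d ≡ ech C (f a) (f b) (f c) (f d))
    × (∀ a b → ord A a b ≡ ord C (f a) (f b))

-- The class of finite ordered echeloned spaces is a Ramsey class.
-- A partition of (C choose A) into k classes is given by a colouring
-- χ of subsets of C with k colours (only its values on copies of A matter).
IsRamseyClassOES : Set
IsRamseyClassOES =
  ∀ (A B : OrdEchSpace) (k : ℕ) → 1 ≤ k →
  Σ OrdEchSpace λ C →
    ∀ (χ : Subset (size C) → Fin k) →
      Σ (Subset (size C)) λ B̃ →
        IsCopy B C B̃ ×
        (Σ (Fin k) λ col →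
          ∀ (S : Subset (size C)) → S ⊆ B̃ → IsCopy A C S → χ S ≡ col)

{-# OPTIONS --safe #-}

-- Up to isomorphism a finite ordered echeloned space is a finite linear order whose pairs are
-- coloured by a second finite linear order of colours, and an embedding is a pair of compatible
-- increasing maps, one on points and one on colours.
--
-- Choose q by Ramsey's theorem and work with q points and q colours.  Fixing the increasing maps
-- of the points and colours of A into q fixes a pattern.  A partite construction makes the colour
-- of a copy of A depend on its pattern only: each step takes one pattern π and replaces the parts
-- by a power, in which the Hales–Jewett theorem, over the alphabet of copies of A with pattern π,
-- yields a copy of the previous partite system with all these copies of A in one colour.  Then
-- Ramsey's theorem, applied to the colouring of the patterns, yields the points and colours of
-- the copy of B.
module Submission where

open import Data.Bool using (true; false; T; T?; if_then_else_)
open import Data.Fin as Fin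
  using (Fin; zero; suc; toℕ; _↑ˡ_; _↑ʳ_; splitAt; inject≤; combine; remQuot)
import Data.Fin.Properties as Fin
open import Data.Fin.Subset as Subset using (Subset)
import Data.Fin.Subset.Properties as Subset
open import Data.List as List using (List; []; _∷_; length)
open import Data.List.Membership.Propositional using (_∈_)
import Data.List.Membership.Propositional.Properties as List
import Data.List.Properties as List
open import Data.List.Relation.Binary.Sublist.Propositional
  using (_⊆_; []; _∷_; _∷ʳ_; minimum; ⊆-refl; ⊆-trans)
import Data.List.Relation.Binary.Sublist.Propositional.Properties as Sublist
open import Data.List.Relation.Unary.All as ListAll using ([]; _∷_)
import Data.List.Relation.Unary.All.Properties as ListAll
open import Data.List.Relation.Unary.AllPairs using (AllPairs; []; _∷_)
import Data.List.Relation.Unary.AllPairs.Properties as AllPairs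
open import Data.List.Relation.Unary.Any as Any using (Any; here; there)
import Data.List.Relation.Unary.Any.Properties as Any
open import Data.Maybe using (Maybe; just; nothing; maybe; fromMaybe)
import Data.Maybe.Properties as Maybe
open import Data.Maybe.Relation.Unary.All as Maybe using (just; nothing)
open import Data.Nat as ℕ
  using (ℕ; zero; suc; _+_; _*_; _^_; _≤_; _<_; z≤n; s≤s; s<s; z<s; s<s⁻¹; _≤ᵇ_)
import Data.Nat.Properties as ℕ
open import Data.Product using (Σ; ∃; _×_; _,_; proj₁; proj₂; uncurry)
open import Data.Sum using (_⊎_; inj₁; inj₂; [_,_]′)
open import Data.Vec as Vec using (Vec; []; _∷_; _++_; toList)
import Data.Vec.Membership.Propositional as Vec
import Data.Vec.Membership.Propositional.Properties as Vec
import Data.Vec.Properties as Vec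
open import Data.Vec.Relation.Unary.All as All using (All; []; _∷_)
import Data.Vec.Relation.Unary.All.Properties as All
import Data.Vec.Relation.Unary.Any as VecAny
import Data.Vec.Relation.Unary.Any.Properties as VecAny
open import Function using (_∘_)
open import Function.Definitions using (Injective)
open import Level using (0ℓ)
open import Relation.Binary using (Rel; Decidable; Total; Transitive; tri<; tri≈; tri>)
open import Relation.Binary.PropositionalEquality
open import Relation.Nullary using (¬_; Dec; yes; no; does; contradiction; ¬?)
open import Relation.Unary as Unary using (Pred)
open import Defs

private
  variable
    X Y : Set
    n k r : ℕ

-- The Hales–Jewett theorem

words : List X → ∀ n → List (Vec X n)
words L zero    = [] ∷ []
words L (suc n) = List.cartesianProductWith _∷_ L (words L n)

∈-words : {L : List X} {v : Vec X n} → All (_∈ L) v → v ∈ words L n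
∈-words []       = here refl
∈-words (p ∷ ps) = List.∈-cartesianProductWith⁺ _∷_ p (∈-words ps)

funToFin-injective : ∀ {m} (f g : Fin m → Fin k) →
                     Fin.funToFin f ≡ Fin.funToFin g → f ≗ g
funToFin-injective f g eq i = begin
  f i                              ≡⟨ Fin.finToFun-funToFin f i ⟨
  Fin.finToFun (Fin.funToFin f) i  ≡⟨ cong (λ c → Fin.finToFun c i) eq ⟩
  Fin.finToFun (Fin.funToFin g) i  ≡⟨ Fin.finToFun-funToFin g i ⟩
  g i                              ∎
  where open ≡-Reasoning

-- A combinatorial line is a word in which `nothing` marks the active positions.
fill : Vec (Maybe X) n → X → Vec X n
fill w x = Vec.map (fromMaybe x) w

fill-++ : ∀ {m} (v : Vec (Maybe X) m) (w : Vec (Maybe X) n) x →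
          fill (v ++ w) x ≡ fill v x ++ fill w x
fill-++ v w x = Vec.map-++ (fromMaybe x) v w

fill-just : ∀ (u : Vec X n) x → fill (Vec.map just u) x ≡ u
fill-just u x = trans (sym (Vec.map-∘ (fromMaybe x) just u)) (Vec.map-id u)

Over : List X → Vec (Maybe X) n → Set
Over L = All (Maybe.All (_∈ L))

just-Over : {L : List X} {u : Vec X n} → All (_∈ L) u → Over L (Vec.map just u)
just-Over = All.map⁺ ∘ All.map just

fill-Over : {L : List X} {w : Vec (Maybe X) n} {x : X} →
            Over L w → x ∈ L → All (_∈ L) (fill w x)
fill-Over []             x∈L = []
fill-Over (nothing ∷ ps) x∈L = x∈L ∷ fill-Over ps x∈L
fill-Over (just p ∷ ps)  x∈L = p ∷ fill-Over ps x∈L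

record MonochromaticLine (L : List X) (χ : Vec X n → Fin k) : Set where
  field
    line   : Vec (Maybe X) n
    over   : Over L line
    active : nothing Vec.∈ line
    colour : Fin k
    mono   : ∀ {x} → x ∈ L → χ (fill line x) ≡ colour

-- Colour focusing for the step that adds the letter x to the alphabet L: the lines are controlled
-- on L only, their colours differ pairwise, and all of them arrive at the same point when filled
-- with x.
record ColourFocused (x : X) (L : List X) (r : ℕ) (χ : Vec X n → Fin k) : Set where
  field
    focus      : Vec X n
    focus-over : All (_∈ x ∷ L) focus
    lines      : Fin r → Vec (Maybe X) n
    over       : ∀ i → Over (x ∷ L) (lines i)
    active     : ∀ i → nothing Vec.∈ lines i
    colours    : Fin r → Fin k
    distinct   : Injective _≡_ _≡_ colours
    mono       : ∀ i {z} → z ∈ L → χ (fill (lines i) z) ≡ colours i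
    focused    : ∀ i → fill (lines i) x ≡ focus

HalesJewett : List X → ℕ → Set
HalesJewett {X} L k = Σ ℕ λ n → (χ : Vec X n → Fin k) → MonochromaticLine L χ

module _ (x y : X) (L : List X) (k : ℕ) (ih : ∀ m → HalesJewett (y ∷ L) m) where

  private
    module M = MonochromaticLine
    module F = ColourFocused

  module FocusStep
    (n : ℕ) (focus? : (χ : Vec X n → Fin k) →
                      MonochromaticLine (x ∷ y ∷ L) χ ⊎ ColourFocused x (y ∷ L) r χ)
    where

    W : List (Vec X n)
    W = words (x ∷ y ∷ L) n

    N : ℕ
    -- A prefix is coloured by the whole function that χ induces on its extensions in `W`. There are
    -- k ^ length W such functions, so the induction hypothesis has to cover every number of
    -- colours.
    N = proj₁ (ih (k ^ List.length W))

    module _ (χ : Vec X (N + n) → Fin k) where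

      encode : Vec X N → Fin (k ^ List.length W)
      encode v = Fin.funToFin (λ i → χ (v ++ List.lookup W i))

      first : MonochromaticLine (y ∷ L) encode
      first = proj₂ (ih (k ^ List.length W)) encode

      v : Vec (Maybe X) N
      v = M.line first

      v-over : Over (x ∷ y ∷ L) v
      v-over = All.map (Maybe.map there) (M.over first)

      -- By `stable`, any letter of y ∷ L in place of y gives the same colours on words over the
      -- full alphabet.
      χ* : Vec X n → Fin k
      χ* u = χ (fill v y ++ u)

      -- The line v is monochromatic for the colouring of its points by all their extensions.
      stable : ∀ {z u} → z ∈ y ∷ L → All (_∈ x ∷ y ∷ L) u → χ (fill v z ++ u) ≡ χ* u
      stable {z} {u} z∈ u∈ =
        subst (λ u → χ (fill v z ++ u) ≡ χ* u) (sym (Any.lookup-index i))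
          (funToFin-injective _ _ (trans (M.mono first z∈) (sym (M.mono first (here refl)))) (Any.index i))
        where i = ∈-words u∈

      lift : MonochromaticLine (x ∷ y ∷ L) χ* → MonochromaticLine (x ∷ y ∷ L) χ
      lift l = record
        { line   = Vec.map just (fill v y) ++ M.line l
        ; over   = All.++⁺ (just-Over (fill-Over v-over (there (here refl)))) (M.over l)
        ; active = Vec.∈-++⁺ʳ (Vec.map just (fill v y)) (M.active l)
        ; colour = M.colour l
        ; mono   = λ {z} z∈ → trans
            (cong χ (trans (fill-++ (Vec.map just (fill v y)) (M.line l) z)
                           (cong (_++ fill (M.line l) z) (fill-just (fill v y) z))))
            (M.mono l z∈)
        }

      -- Line i already has one colour on y ∷ L and passes through the focus at x. If the focus has
      -- this colour too, the line is monochromatic on the full alphabet.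
      collapse : (f : ColourFocused x (y ∷ L) r χ*) → ∀ i →
                 F.colours f i ≡ χ* (F.focus f) → MonochromaticLine (x ∷ y ∷ L) χ*
      collapse f i eq = record
        { line   = F.lines f i
        ; over   = F.over f i
        ; active = F.active f i
        ; colour = F.colours f i
        ; mono   = λ { (here refl) → trans (cong χ* (F.focused f i)) (sym eq)
                     ; (there z∈)  → F.mono f i z∈ }
        }

      -- Each old line is prolonged by v, both moving together; the new line moves along v and stays
      -- at the old focus, whose colour is new. At the letter x they all meet in
      -- `fill v x ++ F.focus f`.
      extend : (f : ColourFocused x (y ∷ L) r χ*) →
               (∀ i → F.colours f i ≢ χ* (F.focus f)) → ColourFocused x (y ∷ L) (suc r) χ
      extend f new = record
        { focus      = fill v x ++ F.focus f
        ; focus-over = All.++⁺ (fill-Over v-over (here refl)) (F.focus-over f)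
        ; lines      = λ { zero → v ++ p ; (suc i) → v ++ F.lines f i }
        ; over       = λ { zero → All.++⁺ v-over (just-Over (F.focus-over f))
                         ; (suc i) → All.++⁺ v-over (F.over f i) }
        ; active     = λ { zero → Vec.∈-++⁺ˡ (M.active first) ; (suc i) → Vec.∈-++⁺ˡ (M.active first) }
        ; colours    = λ { zero → χ* (F.focus f) ; (suc i) → F.colours f i }
        ; distinct   = λ { {zero} {zero} _ → refl
                         ; {zero} {suc j} eq → contradiction (sym eq) (new j)
                         ; {suc i} {zero} eq → contradiction eq (new i)
                         ; {suc i} {suc j} eq → cong suc (F.distinct f eq) }
        ; mono       = λ { zero {z} z∈ → trans (cong χ (fill-fixed z)) (stable z∈ (F.focus-over f))
                         ; (suc i) {z} z∈ → trans (cong χ (fill-++ v (F.lines f i) z))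
                             (trans (stable z∈ (fill-Over (F.over f i) (there z∈))) (F.mono f i z∈)) }
        ; focused    = λ { zero → fill-fixed x
                         ; (suc i) → trans (fill-++ v (F.lines f i) x)
                                           (cong (fill v x ++_) (F.focused f i)) }
        }
        where
        p = Vec.map just (F.focus f)
        fill-fixed : ∀ z → fill (v ++ p) z ≡ fill v z ++ F.focus f
        fill-fixed z = trans (fill-++ v p z) (cong (fill v z ++_) (fill-just (F.focus f) z))

      step : MonochromaticLine (x ∷ y ∷ L) χ ⊎ ColourFocused x (y ∷ L) (suc r) χ
      step with focus? χ*
      ... | inj₁ l = inj₁ (lift l)
      ... | inj₂ f with Fin.any? (λ i → F.colours f i Fin.≟ χ* (F.focus f))
      ...   | yes (i , eq) = inj₁ (lift (collapse f i eq))
      ...   | no  new      = inj₂ (extend f (λ i eq → new (i , eq)))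

  colour-focusing : ∀ r → Σ ℕ λ n → (χ : Vec X n → Fin k) →
                    MonochromaticLine (x ∷ y ∷ L) χ ⊎ ColourFocused x (y ∷ L) r χ
  colour-focusing zero = 0 , λ χ → inj₂ record
    { focus = [] ; focus-over = [] ; lines = λ () ; over = λ () ; active = λ ()
    ; colours = λ () ; distinct = λ { {()} } ; mono = λ () ; focused = λ () }
  colour-focusing (suc r) =
    let n , focus? = colour-focusing r in
    FocusStep.N n focus? + n , FocusStep.step n focus?

hales-jewett : ∀ (x : X) L k → HalesJewett (x ∷ L) k
hales-jewett x [] k = 1 , λ χ → record
  { line = nothing ∷ [] ; over = nothing ∷ [] ; active = VecAny.here refl
  ; colour = χ (x ∷ []) ; mono = λ { (here refl) → refl } }
hales-jewett x (y ∷ L) k =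
  -- Focusing suc k lines would need suc k distinct colours among k, so only the monochromatic line
  -- remains.
  let n , focus? = colour-focusing x y L k (hales-jewett y L) (suc k) in
  n , λ χ → resolve (focus? χ)
  where
  resolve : {χ : Vec _ n → Fin k} →
            MonochromaticLine (x ∷ y ∷ L) χ ⊎ ColourFocused x (y ∷ L) (suc k) χ →
            MonochromaticLine (x ∷ y ∷ L) χ
  resolve (inj₁ l) = l
  resolve (inj₂ f) = contradiction (Fin.injective⇒≤ (ColourFocused.distinct f)) ℕ.1+n≰n

-- Ramsey's theorem

length-filter-split : {P : Pred X 0ℓ} (P? : Unary.Decidable P) (xs : List X) →
  length (List.filter P? xs) + length (List.filter (¬? ∘ P?) xs) ≡ length xs
length-filter-split P? []       = refl
length-filter-split P? (x ∷ xs) with ih ← length-filter-split P? xs | P? x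
... | yes _ = cong suc ih
... | no  _ = trans (ℕ.+-suc _ _) (cong suc ih)

module _ (f : X → Fin k) (b : ℕ) where

  -- Pigeonhole, one colour at a time: if fewer than b elements have colour c, discarding them costs
  -- at most b and leaves only the colours `cs`. The strict bound makes the case without colours
  -- impossible.
  popular-colour′ : ∀ cs xs → ListAll.All (λ x → f x ∈ cs) xs → length cs * b < length xs →
                    Σ (Fin k) λ c → Σ (List X) λ ys →
                      ys ⊆ xs × b ≤ length ys × ListAll.All (λ y → f y ≡ c) ys
  popular-colour′ []       (x ∷ xs) (() ∷ _) _
  popular-colour′ (c ∷ cs) xs f∈ big with b ℕ.≤? length (List.filter (λ x → f x Fin.≟ c) xs)
  ... | yes b≤ = c , _ , Sublist.filter-⊆ _ xs , b≤ , ListAll.all-filter _ xs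
  ... | no  b≰ =
    let d , ys , ys⊆ , rest = popular-colour′ cs others others∈ big′ in
    d , ys , ⊆-trans ys⊆ (Sublist.filter-⊆ _ xs) , rest
    where
    others : List X
    others = List.filter (λ x → ¬? (f x Fin.≟ c)) xs
    others∈ : ListAll.All (λ x → f x ∈ cs) others
    others∈ = ListAll.zipWith (λ { (here eq , ≢c) → contradiction eq ≢c ; (there p , _) → p })
                (Sublist.All-resp-⊆ (Sublist.filter-⊆ _ xs) f∈ , ListAll.all-filter _ xs)
    big′ : length cs * b < length others
    big′ = ℕ.+-cancelˡ-< b _ _ (ℕ.<-≤-trans big
      (ℕ.≤-trans (ℕ.≤-reflexive (sym (length-filter-split (λ x → f x Fin.≟ c) xs)))
                 (ℕ.+-monoˡ-≤ _ (ℕ.<⇒≤ (ℕ.≰⇒> b≰)))))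

  popular-colour : ∀ xs → k * b < length xs →
                   Σ (Fin k) λ c → Σ (List X) λ ys →
                     ys ⊆ xs × b ≤ length ys × ListAll.All (λ y → f y ≡ c) ys
  popular-colour xs big = popular-colour′ (List.allFin k) xs
    (ListAll.universal (λ x → List.∈-allFin (f x)) xs)
    (subst (λ m → m * b < length xs) (sym (List.length-tabulate {n = k} (λ i → i))) big)

-- The colour of a tuple is determined by its first entry alone, and this colour is stored beside
-- the entry.
data EndHomogeneous (χ : Vec X (suc n) → Fin k) : List (X × Fin k) → Set where
  []  : EndHomogeneous χ []
  _∷_ : ∀ {x c ps} → (∀ z → toList z ⊆ List.map proj₁ ps → χ (x ∷ z) ≡ c) →
        EndHomogeneous χ ps → EndHomogeneous χ ((x , c) ∷ ps)

module _ {χ : Vec X (suc n) → Fin k} where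

  EndHomogeneous-resp-⊆ : ∀ {ps qs} → qs ⊆ ps → EndHomogeneous χ ps → EndHomogeneous χ qs
  EndHomogeneous-resp-⊆ []         []       = []
  EndHomogeneous-resp-⊆ (_ ∷ʳ τ)   (_ ∷ hs) = EndHomogeneous-resp-⊆ τ hs
  EndHomogeneous-resp-⊆ (refl ∷ τ) (h ∷ hs) =
    (λ z z⊆ → h z (⊆-trans z⊆ (Sublist.map⁺ proj₁ τ))) ∷ EndHomogeneous-resp-⊆ τ hs

  end-homogeneous⇒homogeneous : ∀ {ps c} → EndHomogeneous χ ps → ListAll.All (λ p → proj₂ p ≡ c) ps →
                                ∀ z → toList z ⊆ List.map proj₁ ps → χ z ≡ c
  end-homogeneous⇒homogeneous (h ∷ hs) (refl ∷ eqs) (_ ∷ z) (refl ∷ z⊆) = h z z⊆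
  end-homogeneous⇒homogeneous (h ∷ hs) (_ ∷ eqs)    (x ∷ z) (_ ∷ʳ z⊆)   =
    end-homogeneous⇒homogeneous hs eqs (x ∷ z) z⊆

-- An a-subset of a list is a vector whose entries form a sublist. Stating the theorem for arbitrary
-- lists lets the induction pass to thinned tails.
Ramsey : (a b k : ℕ) → Set₁
Ramsey a b k = Σ ℕ λ q → ∀ {X : Set} (χ : Vec X a → Fin k) (xs : List X) → q ≤ length xs →
  Σ (List X) λ ys → ys ⊆ xs × b ≤ length ys ×
    Σ (Fin k) λ c → ∀ z → toList z ⊆ ys → χ z ≡ c

module _ (a k : ℕ) (ramsey-a : ∀ b → Ramsey a b k) where

  -- The head x induces a colouring of a-subsets of the tail; the tail is thinned to a set
  -- homogeneous for it, and the construction continues inside that set.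
  end-homogeneous : ∀ m → Σ ℕ λ q → ∀ {X : Set} (χ : Vec X (suc a) → Fin k) (xs : List X) →
    q ≤ length xs →
    Σ (List (X × Fin k)) λ ps → List.map proj₁ ps ⊆ xs × m ≤ length ps × EndHomogeneous χ ps
  end-homogeneous zero    = 0 , λ χ xs _ → [] , minimum xs , z≤n , []
  end-homogeneous (suc m) =
    let q₁ , thin = end-homogeneous m
        q₂ , hom  = ramsey-a q₁ in
    suc q₂ , λ where
      χ (x ∷ xs) (s≤s q₂≤) →
        let ys , ys⊆ , q₁≤ , c , h = hom (λ z → χ (x ∷ z)) xs q₂≤
            ps , ps⊆ , m≤ , hs     = thin χ ys q₁≤ in
        (x , c) ∷ ps , refl ∷ ⊆-trans ps⊆ ys⊆ , s≤s m≤ , (λ z z⊆ → h z (⊆-trans z⊆ ps⊆)) ∷ hs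

ramsey : ∀ a b k → Ramsey a b k
ramsey zero    b k = b , λ χ xs b≤ → xs , ⊆-refl , b≤ , χ [] , λ { [] _ → refl }
ramsey (suc a) b k =
  -- Among more than k * b entries, some stored colour occurs at least b times.
  let q , thin = end-homogeneous a k (λ b → ramsey a b k) (suc (k * b)) in
  q , λ χ xs q≤ →
    let ps , ps⊆ , big , hs     = thin χ xs q≤
        c , qs , qs⊆ , b≤ , eqs = popular-colour proj₂ b ps big in
    List.map proj₁ qs , ⊆-trans (Sublist.map⁺ proj₁ qs⊆) ps⊆ ,
    subst (b ≤_) (sym (List.length-map proj₁ qs)) b≤ ,
    c , end-homogeneous⇒homogeneous (EndHomogeneous-resp-⊆ qs⊆ hs) eqs

-- Increasing maps and the product form of Ramsey's theorem

StrictlyMonotone : (Fin n → Fin r) → Set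
StrictlyMonotone f = ∀ {i j} → i Fin.< j → f i Fin.< f j

strictly-monotone⇒injective : {f : Fin n → Fin r} → StrictlyMonotone f → ∀ {i j} → f i ≡ f j → i ≡ j
strictly-monotone⇒injective f↗ {i} {j} eq with Fin.<-cmp i j
... | tri< i<j _ _ = contradiction eq (Fin.<⇒≢ (f↗ i<j))
... | tri≈ _ i≡j _ = i≡j
... | tri> _ _ i>j = contradiction (sym eq) (Fin.<⇒≢ (f↗ i>j))

strictly-monotone⇒monotone : {f : Fin n → Fin r} → StrictlyMonotone f → ∀ {i j} → i Fin.≤ j → f i Fin.≤ f j
strictly-monotone⇒monotone f↗ {i} {j} i≤j with Fin.<-cmp i j
... | tri< i<j _ _  = ℕ.<⇒≤ (f↗ i<j)
... | tri≈ _ refl _ = ℕ.≤-refl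
... | tri> _ _ j<i  = contradiction i≤j (ℕ.<⇒≱ j<i)

lower-positive : (e : Fin n → Fin (suc r)) → (∀ i → 0 < toℕ (e i)) →
                 Σ (Fin n → Fin r) λ e′ → e ≗ suc ∘ e′
lower-positive e pos = (λ i → proj₁ (lower (e i) (pos i))) , (λ i → proj₂ (lower (e i) (pos i)))
  where
  lower : (i : Fin (suc r)) → 0 < toℕ i → ∃ λ j → i ≡ suc j
  lower (suc j) _ = j , refl

-- If `e zero` is 0, the head of the list is taken and the later indices are positive; otherwise all
-- indices are positive and the head is skipped. The positive indices are lowered by one.
lookups-⊆ : ∀ (ys : List X) (e : Fin n → Fin (length ys)) → StrictlyMonotone e →
            toList (Vec.tabulate (List.lookup ys ∘ e)) ⊆ ys
lookups-⊆ {n = zero}  ys       e e↗ = minimum ys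
lookups-⊆ {n = suc n} []       e e↗ with () ← e zero
lookups-⊆ {n = suc n} (y ∷ ys) e e↗ with e zero in e₀
... | zero =
  let e′ , eq = lower-positive (e ∘ suc) (λ i → subst (Fin._< e (suc i)) e₀ (e↗ z<s)) in
  refl ∷ subst (λ v → toList v ⊆ ys) (Vec.tabulate-cong (λ i → cong (List.lookup (y ∷ ys)) (sym (eq i))))
    (lookups-⊆ ys e′ λ {i} {j} i<j → s<s⁻¹ (subst₂ Fin._<_ (eq i) (eq j) (e↗ (s<s i<j))))
... | suc i₀ =
  let e′ , eq = lower-positive e (λ { zero → subst (λ i → 0 < toℕ i) (sym e₀) z<s
                                    ; (suc i) → ℕ.≤-<-trans z≤n (e↗ {zero} {suc i} z<s) }) in
  y ∷ʳ subst (λ v → toList v ⊆ ys)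
    (cong₂ _∷_ (cong (List.lookup (y ∷ ys)) (trans (sym (eq zero)) e₀))
               (Vec.tabulate-cong (λ i → cong (List.lookup (y ∷ ys)) (sym (eq (suc i))))))
    (lookups-⊆ ys e′ λ {i} {j} i<j → s<s⁻¹ (subst₂ Fin._<_ (eq i) (eq j) (e↗ i<j)))

AllPairs-resp-⊆ : {R : Rel X 0ℓ} {xs ys : List X} → ys ⊆ xs → AllPairs R xs → AllPairs R ys
AllPairs-resp-⊆ []         []       = []
AllPairs-resp-⊆ (_ ∷ʳ τ)   (_ ∷ ps) = AllPairs-resp-⊆ τ ps
AllPairs-resp-⊆ (refl ∷ τ) (p ∷ ps) = Sublist.All-resp-⊆ τ p ∷ AllPairs-resp-⊆ τ ps

AllPairs-lookup : {R : Rel X 0ℓ} {xs : List X} → AllPairs R xs → ∀ {i j} → i Fin.< j →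
                  R (List.lookup xs i) (List.lookup xs j)
AllPairs-lookup (p ∷ ps) {zero}  {suc j} _         = ListAll.lookup p (List.∈-lookup j)
AllPairs-lookup (p ∷ ps) {suc i} {suc j} (s≤s i<j) = AllPairs-lookup ps i<j

_⊕_ : ∀ {a b c} → (Fin a → Fin b) → (Fin r → Fin c) → Fin (a + r) → Fin (b + c)
_⊕_ {a = a} {b = b} {c} f g = [ (λ i → f i ↑ˡ c) , (λ j → b ↑ʳ g j) ]′ ∘ splitAt a

⊕-strictly-monotone : ∀ {a b c} {f : Fin a → Fin b} {g : Fin r → Fin c} →
                      StrictlyMonotone f → StrictlyMonotone g → StrictlyMonotone (f ⊕ g)
⊕-strictly-monotone {r = r} {a} {b} {c} {f} {g} f↗ g↗ {i} {j} i<j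
  with splitAt a i in eqᵢ | splitAt a j in eqⱼ
... | inj₁ i′ | inj₁ j′
  rewrite sym (Fin.splitAt⁻¹-↑ˡ {n = r} {i} eqᵢ) | sym (Fin.splitAt⁻¹-↑ˡ {n = r} {j} eqⱼ)
        | Fin.toℕ-↑ˡ i′ r | Fin.toℕ-↑ˡ j′ r | Fin.toℕ-↑ˡ (f i′) c | Fin.toℕ-↑ˡ (f j′) c = f↗ i<j
... | inj₁ i′ | inj₂ j′
  rewrite Fin.toℕ-↑ˡ (f i′) c | Fin.toℕ-↑ʳ b (g j′) = ℕ.<-≤-trans (Fin.toℕ<n (f i′)) (ℕ.m≤m+n b _)
... | inj₂ i′ | inj₁ j′
  rewrite sym (Fin.splitAt⁻¹-↑ʳ {m = a} {i = i} eqᵢ) | sym (Fin.splitAt⁻¹-↑ˡ {n = r} {j} eqⱼ)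
        | Fin.toℕ-↑ʳ a i′ | Fin.toℕ-↑ˡ j′ r =
  contradiction (ℕ.<-trans i<j (Fin.toℕ<n j′)) (ℕ.m+n≮m a _)
... | inj₂ i′ | inj₂ j′
  rewrite sym (Fin.splitAt⁻¹-↑ʳ {m = a} {i = i} eqᵢ) | sym (Fin.splitAt⁻¹-↑ʳ {m = a} {i = j} eqⱼ)
        | Fin.toℕ-↑ʳ a i′ | Fin.toℕ-↑ʳ a j′ | Fin.toℕ-↑ʳ b (g i′) | Fin.toℕ-↑ʳ b (g j′) =
  ℕ.+-monoʳ-< b (g↗ (ℕ.+-cancelˡ-< a _ _ i<j))

abstract
  -- One application of Ramsey's theorem to (a + r)-subsets: the first a elements are read in the
  -- first b elements of the homogeneous set, the last r elements in its last c elements.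
  product-ramsey : ∀ a r b c k → Σ ℕ λ q → (χ : Vec (Fin q) a → Vec (Fin q) r → Fin k) →
    Σ (Fin b → Fin q) λ s → Σ (Fin c → Fin q) λ t →
      StrictlyMonotone s × StrictlyMonotone t × Σ (Fin k) λ colour →
        ∀ (f : Fin a → Fin b) (g : Fin r → Fin c) → StrictlyMonotone f → StrictlyMonotone g →
        χ (Vec.tabulate (s ∘ f)) (Vec.tabulate (t ∘ g)) ≡ colour
  product-ramsey a r b c k = q , λ χ →
    let
      left : Vec (Fin q) (a + r) → Vec (Fin q) a
      left z = Vec.tabulate (λ i → Vec.lookup z (i ↑ˡ r))
      right : Vec (Fin q) (a + r) → Vec (Fin q) r
      right z = Vec.tabulate (λ j → Vec.lookup z (a ↑ʳ j))
      ys , ys⊆ , b+c≤ , colour , hom =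
        proj₂ (ramsey (a + r) (b + c) k) (λ z → χ (left z) (right z)) (List.allFin q)
          (ℕ.≤-reflexive (sym (List.length-tabulate {n = q} (λ i → i))))
      embed : Fin (b + c) → Fin (length ys)
      embed i = inject≤ i b+c≤
      embed↗ : StrictlyMonotone embed
      embed↗ {i} {j} i<j = subst₂ _<_ (sym (Fin.toℕ-inject≤ i b+c≤)) (sym (Fin.toℕ-inject≤ j b+c≤)) i<j
      h : Fin (b + c) → Fin q
      h = List.lookup ys ∘ embed
      h↗ : StrictlyMonotone h
      h↗ i<j = AllPairs-lookup (AllPairs-resp-⊆ ys⊆ (AllPairs.tabulate⁺-< (λ i<j → i<j))) (embed↗ i<j)
    in
    (λ i → h (i ↑ˡ c)) , (λ j → h (b ↑ʳ j)) ,
    (λ {i} {j} i<j → h↗ (subst₂ _<_ (sym (Fin.toℕ-↑ˡ i c)) (sym (Fin.toℕ-↑ˡ j c)) i<j)) ,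
    (λ {i} {j} i<j → h↗ (subst₂ _<_ (sym (Fin.toℕ-↑ʳ b i)) (sym (Fin.toℕ-↑ʳ b j)) (ℕ.+-monoʳ-< b i<j))) ,
    colour ,
    λ f g f↗ g↗ →
      let z = Vec.tabulate (h ∘ (f ⊕ g)) in
      trans
        (cong₂ χ
          (Vec.tabulate-cong (λ i → sym (trans (Vec.lookup∘tabulate (h ∘ (f ⊕ g)) (i ↑ˡ r))
            (cong (h ∘ [ (λ i → f i ↑ˡ c) , (λ j → b ↑ʳ g j) ]′) (Fin.splitAt-↑ˡ a i r)))))
          (Vec.tabulate-cong (λ j → sym (trans (Vec.lookup∘tabulate (h ∘ (f ⊕ g)) (a ↑ʳ j))
            (cong (h ∘ [ (λ i → f i ↑ˡ c) , (λ j → b ↑ʳ g j) ]′) (Fin.splitAt-↑ʳ a r j))))))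
        (hom z (lookups-⊆ ys (embed ∘ (f ⊕ g)) (λ i<j → embed↗ (⊕-strictly-monotone f↗ g↗ i<j))))
    where
    q : ℕ
    q = proj₁ (ramsey (a + r) (b + c) k)

-- The partite construction

∈-words-allFin : ∀ {m} (v : Vec (Fin m) n) → v ∈ words (List.allFin m) n
∈-words-allFin v = ∈-words (All.universal List.∈-allFin v)

funToFin-cong : ∀ {n m} {f g : Fin n → Fin m} → f ≗ g → Fin.funToFin f ≡ Fin.funToFin g
funToFin-cong {zero}  f≗g = refl
funToFin-cong {suc n} f≗g = cong₂ combine (f≗g zero) (funToFin-cong (f≗g ∘ suc))

firstJust : (Fin n → Maybe Y) → Y → Y
firstJust {zero}  o y = y
firstJust {suc n} o y = fromMaybe (firstJust (o ∘ suc) y) (o zero)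

firstJust-≡ : ∀ (o : Fin n → Maybe Y) {y c} → (∀ t → o t ≡ nothing ⊎ o t ≡ just c) →
              y ≡ c ⊎ (∃ λ t → o t ≡ just c) → firstJust o y ≡ c
firstJust-≡ {zero}  o all (inj₁ eq) = eq
firstJust-≡ {suc n} o {y} {c} all ex with all zero
... | inj₂ eq rewrite eq = refl
... | inj₁ eq rewrite eq = firstJust-≡ (o ∘ suc) (all ∘ suc) (later ex)
  where
  later : y ≡ c ⊎ (∃ λ t → o t ≡ just c) → y ≡ c ⊎ (∃ λ t → o (suc t) ≡ just c)
  later (inj₁ y≡c)         = inj₁ y≡c
  later (inj₂ (zero , eq′)) = contradiction (trans (sym eq) eq′) λ ()
  later (inj₂ (suc t , eq′)) = inj₂ (t , eq′)

record Partite (q : ℕ) : Set where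
  field
    partSize : ℕ
    edge     : Fin q → Fin q → Fin partSize → Fin partSize → Fin q

open Partite

record Embedding {q} (P Q : Partite q) : Set where
  field
    vmap      : Fin q → Fin (partSize P) → Fin (partSize Q)
    vmap-edge : ∀ j j′ x y → edge Q j j′ (vmap j x) (vmap j′ y) ≡ edge P j j′ x y

open Embedding

Pattern : ℕ → Set
Pattern q = Fin q → Fin q → Fin q

module _ {q a : ℕ} (m : Fin a → Fin q) where

  Matches : (P : Partite q) → Pattern q → (Fin q → Fin (partSize P)) → Set
  Matches P π x = ∀ i i′ → edge P (m i) (m i′) (x (m i)) (x (m i′)) ≡ π (m i) (m i′)

  restrict : (Fin q → X) → Vec X a
  restrict x = Vec.tabulate (x ∘ m)

module PartiteStep {q a : ℕ} (m : Fin a → Fin q) (π : Pattern q) (k : ℕ) (P : Partite q) where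

  s : ℕ
  s = partSize P

  -- In each part a vertex of P or a blank. A copy of A becomes the letter that is blank outside the
  -- parts it meets.
  Letter : Set
  Letter = Vec (Fin (suc s)) q

  -- In Fin (suc s), zero is a blank.  An observation that is blank or agrees with the default
  -- colour π j j′ tells nothing.
  observe : Fin q → Fin q → Fin (suc s) → Fin (suc s) → Maybe (Fin q)
  observe j j′ (suc x) (suc y) with edge P j j′ x y Fin.≟ π j j′
  ... | yes _ = nothing
  ... | no  _ = just (edge P j j′ x y)
  observe j j′ (suc _) zero = nothing
  observe j j′ zero    _    = nothing

  Neutral : Letter → Set
  Neutral f = ∀ j j′ → observe j j′ (Vec.lookup f j) (Vec.lookup f j′) ≡ nothing

  neutral? : ∀ f → Dec (Neutral f)
  neutral? f = Fin.all? λ j → Fin.all? λ j′ → Maybe.≡-dec Fin._≟_ _ _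

  blank : Letter
  blank = Vec.replicate q zero

  blank-neutral : Neutral blank
  blank-neutral j j′ = cong₂ (observe j j′) (Vec.lookup-replicate j zero) (Vec.lookup-replicate j′ zero)

  neutrals : List Letter
  neutrals = List.filter neutral? (words (List.allFin (suc s)) q)

  letters-neutral : ∀ {f} → f ∈ blank ∷ neutrals → Neutral f
  letters-neutral (here refl) = blank-neutral
  letters-neutral (there f∈)  = proj₂ (List.∈-filter⁻ neutral? {xs = words _ q} f∈)

  -- The blank letter is prepended because Hales–Jewett is stated for non-empty alphabets.
  hj : HalesJewett (blank ∷ neutrals) k
  hj = hales-jewett blank neutrals k

  dim : ℕ
  dim = proj₁ hj

  -- Along a line over neutral letters every observation at a fixed position is nothing, so the
  -- colour is read at an active position or is the default, and is the colour in P either way.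
  product : Partite q
  product .partSize = suc s ^ dim
  product .edge j j′ u v =
    firstJust (λ t → observe j j′ (Fin.finToFun {suc s} {dim} u t) (Fin.finToFun {suc s} {dim} v t)) (π j j′)

  -- What an active position shows: it is silent only if the default is already the colour in P.
  observe-diag : ∀ j j′ x y → observe j j′ (suc x) (suc y) ≡ nothing × π j j′ ≡ edge P j j′ x y
                 ⊎ observe j j′ (suc x) (suc y) ≡ just (edge P j j′ x y)
  observe-diag j j′ x y with edge P j j′ x y Fin.≟ π j j′
  ... | yes eq = inj₁ (refl , sym eq)
  ... | no  _  = inj₂ refl

  coordinate : Maybe Letter → Fin q → Fin s → Fin (suc s)
  coordinate c j x = maybe (λ f → Vec.lookup f j) (suc x) c

  module _ (w : Vec (Maybe Letter) dim) where

    -- The vertex x appears at the active positions of the line; every other position repeats the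
    -- entry of its fixed letter.
    along : Fin q → Fin s → Fin (suc s ^ dim)
    along j x = Fin.funToFin (λ t → coordinate (Vec.lookup w t) j x)

    along-preserves : Over (blank ∷ neutrals) w → nothing Vec.∈ w → ∀ j j′ x y →
                      edge product j j′ (along j x) (along j′ y) ≡ edge P j j′ x y
    along-preserves over active j j′ x y = firstJust-≡ observed consistent attained
      where
      ★ : Fin dim
      -- Where the true colour is seen if it differs from the default.
      ★ = VecAny.index active
      observed : Fin dim → Maybe (Fin q)
      observed t = observe j j′ (Fin.finToFun {suc s} {dim} (along j x) t)
                                (Fin.finToFun {suc s} {dim} (along j′ y) t)
      decode : ∀ t → observed t ≡
                     observe j j′ (coordinate (Vec.lookup w t) j x) (coordinate (Vec.lookup w t) j′ y)
      decode t = cong₂ (observe j j′) (Fin.finToFun-funToFin _ t) (Fin.finToFun-funToFin _ t)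
      at : ∀ {c} → Maybe.All (_∈ blank ∷ neutrals) c →
           observe j j′ (coordinate c j x) (coordinate c j′ y) ≡ nothing ⊎
           observe j j′ (coordinate c j x) (coordinate c j′ y) ≡ just (edge P j j′ x y)
      at (just f∈) = inj₁ (letters-neutral f∈ j j′)
      at nothing with observe-diag j j′ x y
      ... | inj₁ (eq , _) = inj₁ eq
      ... | inj₂ eq       = inj₂ eq
      consistent : ∀ t → observed t ≡ nothing ⊎ observed t ≡ just (edge P j j′ x y)
      consistent t rewrite decode t = at (All.lookup⁺ over t)
      attained : π j j′ ≡ edge P j j′ x y ⊎ ∃ λ t → observed t ≡ just (edge P j j′ x y)
      attained with observe-diag j j′ x y
      ... | inj₁ (_ , eq) = inj₁ eq
      ... | inj₂ eq       = inj₂ (★ , trans (decode ★)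
        (subst (λ c → observe j j′ (coordinate c j x) (coordinate c j′ y) ≡ _)
               (VecAny.lookup-index active) eq))

  -- Transposition: a word of letters, each with q entries, is read as one vertex of the power in
  -- each part. Through it χ colours words.
  transversal : Vec Letter dim → Fin q → Fin (suc s ^ dim)
  transversal v j = Fin.funToFin (λ t → Vec.lookup (Vec.lookup v t) j)

  -- `Neutral` speaks of all pairs of parts, whereas `Matches` constrains only the parts in the
  -- image of m. The blanks elsewhere bridge the gap.
  mask : (Fin q → Fin s) → Fin q → Fin (suc s)
  mask x j = if does (Fin.any? λ i → m i Fin.≟ j) then suc (x j) else zero

  mask-image : ∀ x i → mask x (m i) ≡ suc (x (m i))
  mask-image x i with Fin.any? (λ i′ → m i′ Fin.≟ m i)
  ... | yes _ = refl
  ... | no ∄i = contradiction (i , refl) ∄i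

  mask-neutral : ∀ x → Matches m P π x → ∀ j j′ → observe j j′ (mask x j) (mask x j′) ≡ nothing
  mask-neutral x match j j′
    with Fin.any? (λ i → m i Fin.≟ j) | Fin.any? (λ i → m i Fin.≟ j′)
  ... | no _           | _    = refl
  ... | yes _          | no _ = refl
  ... | yes (i , refl) | yes (i′ , refl) with edge P (m i) (m i′) (x (m i)) (x (m i′)) Fin.≟ π (m i) (m i′)
  ...   | yes _  = refl
  ...   | no neq = contradiction (match i i′) neq

  letter : (Fin q → Fin s) → Letter
  letter x = Vec.tabulate (mask x)

  letter-neutral : ∀ x → Matches m P π x → Neutral (letter x)
  letter-neutral x match j j′ = trans
    (cong₂ (observe j j′) (Vec.lookup∘tabulate (mask x) j) (Vec.lookup∘tabulate (mask x) j′))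
    (mask-neutral x match j j′)

  transversal-fill : ∀ (w : Vec (Maybe Letter) dim) x i →
                     transversal (fill w (letter x)) (m i) ≡ along w (m i) (x (m i))
  transversal-fill w x i = funToFin-cong λ t →
    trans (cong (λ f → Vec.lookup f (m i)) (Vec.lookup-map t (fromMaybe (letter x)) w))
          (at (Vec.lookup w t))
    where
    at : ∀ c → Vec.lookup (fromMaybe (letter x) c) (m i) ≡ coordinate c (m i) (x (m i))
    at nothing  = trans (Vec.lookup∘tabulate (mask x) (m i)) (mask-image x i)
    at (just f) = refl

  -- Each choice of vertices that matches π gives a letter of the Hales-Jewett alphabet. Filling the
  -- monochromatic line with it yields the image of these vertices under `along`, so they all
  -- receive the colour of the line.
  step : (χ : Vec (Fin (suc s ^ dim)) a → Fin k) → Σ (Embedding P product) λ e → Σ (Fin k) λ c →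
         ∀ x → Matches m P π x → χ (restrict m λ j → vmap e j (x j)) ≡ c
  step χ = record { vmap = along line ; vmap-edge = along-preserves line over active } , colour ,
    λ x match → trans (cong χ (Vec.tabulate-cong (λ i → sym (transversal-fill line x i))))
      (mono (there (List.∈-filter⁺ neutral? (∈-words-allFin (letter x)) (letter-neutral x match))))
    where open MonochromaticLine (proj₂ hj (χ ∘ restrict m ∘ transversal))

module _ {q a k : ℕ} {I : Set} (m : I → Fin a → Fin q) (π : I → Pattern q) where

  -- The systems are built from the head of the list on, but colourings are resolved backwards: the
  -- tail first finds a copy of `product` in Q, and the step for i then works inside it. Homogeneity
  -- for the tail survives since embeddings preserve matching.
  partite-construction : (L : List I) (P : Partite q) → Σ (Partite q) λ Q →
    (χ : I → Vec (Fin (partSize Q)) a → Fin k) → Σ (Embedding P Q) λ e →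
      ∀ {i} → i ∈ L → Σ (Fin k) λ c →
        ∀ x → Matches (m i) P (π i) x → χ i (restrict (m i) λ j → vmap e j (x j)) ≡ c
  partite-construction []      P =
    P , λ χ → record { vmap = λ _ x → x ; vmap-edge = λ _ _ _ _ → refl } , λ ()
  partite-construction (i ∷ L) P = Q , compose
    where
    open PartiteStep (m i) (π i) k P using (product; step)
    Q : Partite q
    Q = proj₁ (partite-construction L product)
    compose : (χ : I → Vec (Fin (partSize Q)) a → Fin k) → Σ (Embedding P Q) λ e →
      ∀ {i′} → i′ ∈ i ∷ L → Σ (Fin k) λ c →
        ∀ x → Matches (m i′) P (π i′) x → χ i′ (restrict (m i′) λ j → vmap e j (x j)) ≡ c
    compose χ = e , homogeneous
      where
      outer = proj₂ (partite-construction L product) χ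
      e₁ = proj₁ outer
      inner = step λ v → χ i (Vec.tabulate λ u → vmap e₁ (m i u) (Vec.lookup v u))
      e₀ = proj₁ inner
      e : Embedding P Q
      e .vmap j x = vmap e₁ j (vmap e₀ j x)
      e .vmap-edge j j′ x y = trans (vmap-edge e₁ j j′ _ _) (vmap-edge e₀ j j′ x y)
      homogeneous : ∀ {i′} → i′ ∈ i ∷ L → Σ (Fin k) λ c →
        ∀ x → Matches (m i′) P (π i′) x → χ i′ (restrict (m i′) λ j → vmap e j (x j)) ≡ c
      homogeneous (here refl) = proj₁ (proj₂ inner) , λ x match →
        trans (cong (χ i) (Vec.tabulate-cong λ u → cong (vmap e₁ (m i u)) (sym (Vec.lookup∘tabulate _ u))))
              (proj₂ (proj₂ inner) x match)
      homogeneous (there i′∈) = let c , h = proj₂ outer i′∈ in c , λ x match →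
        h (λ j → vmap e₀ j (x j)) (λ u u′ → trans (vmap-edge e₀ _ _ _ _) (match u u′))

module _ (q : ℕ) where

  encode : Pattern q → Fin (q ^ (q * q))
  encode π = Fin.funToFin (uncurry π ∘ remQuot q)

  -- The disjoint union of all colourings of q points: the x-th vertices of the parts realise the
  -- colouring with code x, and the colours between different colourings are irrelevant.
  universal : Partite q
  universal .partSize           = q ^ (q * q)
  universal .edge j j′ x _ = Fin.finToFun {q} {q * q} x (combine j j′)

  universal-encode : ∀ π j j′ y → edge universal j j′ (encode π) y ≡ π j j′
  universal-encode π j j′ y = trans (Fin.finToFun-funToFin (uncurry π ∘ remQuot q) (combine j j′))
                                    (cong (uncurry π) (Fin.remQuot-combine j j′))

abstract
  -- The construction starts from `universal`, so every colouring τ of the q points has a copy: the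
  -- image of the vertices with the code of τ.
  partite-ramsey : ∀ {q a k} {I : Set} (m : I → Fin a → Fin q) (π : I → Pattern q) (L : List I) →
    Σ (Partite q) λ P → (χ : I → Vec (Fin (partSize P)) a → Fin k) →
      Σ (Pattern q → Fin q → Fin (partSize P)) λ place →
        (∀ τ j j′ → edge P j j′ (place τ j) (place τ j′) ≡ τ j j′) ×
        (∀ {i} → i ∈ L → Σ (Fin k) λ c →
           ∀ τ → (∀ u v → τ (m i u) (m i v) ≡ π i (m i u) (m i v)) → χ i (restrict (m i) (place τ)) ≡ c)
  partite-ramsey {q} m π L =
    let P , construct = partite-construction m π L (universal q) in
    P , λ χ → let e , hom = construct χ in
      (λ τ j → vmap e j (encode q τ)) ,
      (λ τ j j′ → trans (vmap-edge e j j′ _ _) (universal-encode q τ j j′ (encode q τ))) ,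
      λ i∈ → let c , h = hom i∈ in c , λ τ agree →
        h (λ _ → encode q τ) (λ u v → trans (universal-encode q τ _ _ (encode q τ)) (agree u v))

-- Rankings of total preorders, and spaces given by weights

-- The quotient by the equivalence of a total preorder, numbered in increasing order.
record Ranking {X : Set} (_≼_ : Rel X 0ℓ) : Set where
  field
    height    : ℕ
    rep       : Fin height → X
    rank      : X → Fin height
    rank-mono : ∀ {x y} → x ≼ y → rank x Fin.≤ rank y
    rank-refl : ∀ {x y} → rank x Fin.≤ rank y → x ≼ y
    rank-rep  : ∀ i → rank (rep i) ≡ i

module _ {X : Set} (_≼_ : Rel X 0ℓ) (_≼?_ : Decidable _≼_) (total : Total _≼_) (trans′ : Transitive _≼_) where

  private
    _≺_ _∼_ : Rel X 0ℓ
    x ≺ y = ¬ y ≼ x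
    x ∼ y = x ≼ y × y ≼ x

    ≼-refl : ∀ {x} → x ≼ x
    ≼-refl {x} with total x x
    ... | inj₁ p = p
    ... | inj₂ p = p

    ≺⇒≼ : ∀ {x y} → x ≺ y → x ≼ y
    ≺⇒≼ {x} {y} x≺y with total x y
    ... | inj₁ p = p
    ... | inj₂ p = contradiction p x≺y

    -- An element equivalent to one already present is dropped, so a sorted list holds one
    -- representative of each class.
    insert : X → List X → List X
    insert x [] = x ∷ []
    insert x (y ∷ ys) with x ≼? y | y ≼? x
    ... | no _  | _     = y ∷ insert x ys
    ... | yes _ | yes _ = y ∷ ys
    ... | yes _ | no _  = x ∷ y ∷ ys

    insert-All : ∀ {P : Pred X 0ℓ} {x} ys → P x → ListAll.All P ys → ListAll.All P (insert x ys)
    insert-All [] px [] = px ∷ []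
    insert-All {x = x} (y ∷ ys) px (py ∷ pys) with x ≼? y | y ≼? x
    ... | no _  | _     = py ∷ insert-All ys px pys
    ... | yes _ | yes _ = py ∷ pys
    ... | yes _ | no _  = px ∷ py ∷ pys

    insert-sorted : ∀ {x} ys → AllPairs _≺_ ys → AllPairs _≺_ (insert x ys)
    insert-sorted [] [] = [] ∷ []
    insert-sorted {x} (y ∷ ys) (y≺ ∷ ys↗) with x ≼? y | y ≼? x
    ... | no x⋠y | _      = insert-All ys x⋠y y≺ ∷ insert-sorted ys ys↗
    ... | yes _  | yes _  = y≺ ∷ ys↗
    ... | yes _  | no y⋠x =
      (y⋠x ∷ ListAll.map (λ y≺z z≼x → y⋠x (trans′ (≺⇒≼ y≺z) z≼x)) y≺) ∷ y≺ ∷ ys↗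

    insert-new : ∀ x ys → Any (x ∼_) (insert x ys)
    insert-new x [] = here (≼-refl , ≼-refl)
    insert-new x (y ∷ ys) with x ≼? y | y ≼? x
    ... | no _    | _       = there (insert-new x ys)
    ... | yes x≼y | yes y≼x = here (x≼y , y≼x)
    ... | yes _   | no _    = here (≼-refl , ≼-refl)

    insert-old : ∀ {P : Pred X 0ℓ} {x} ys → Any P ys → Any P (insert x ys)
    insert-old {x = x} (y ∷ ys) p with x ≼? y | y ≼? x
    insert-old (y ∷ ys) (here p)  | no _ | _ = here p
    insert-old (y ∷ ys) (there p) | no _ | _ = there (insert-old ys p)
    ... | yes _ | yes _ = p
    ... | yes _ | no _  = there p

    sort : List X → List X
    sort = List.foldr insert []

    sort-sorted : ∀ xs → AllPairs _≺_ (sort xs)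
    sort-sorted []       = []
    sort-sorted (x ∷ xs) = insert-sorted (sort xs) (sort-sorted xs)

    ∈-sort : ∀ {x xs} → x ∈ xs → Any (x ∼_) (sort xs)
    ∈-sort {xs = x ∷ xs} (here refl) = insert-new x (sort xs)
    ∈-sort {xs = y ∷ xs} (there x∈)  = insert-old (sort xs) (∈-sort x∈)

  abstract
    ranking : (xs : List X) → (∀ x → x ∈ xs) → Ranking _≼_
    ranking xs complete = record
      { height    = length (sort xs)
      ; rep       = rep
      ; rank      = rank
      ; rank-mono = rank-mono
      ; rank-refl = λ {x} {y} le → trans′ (proj₁ (rep-rank x)) (trans′ (rep-mono le) (proj₂ (rep-rank y)))
      ; rank-rep  = λ i → Fin.≤-antisym (rep-reflect (proj₂ (rep-rank (rep i))))
                                        (rep-reflect (proj₁ (rep-rank (rep i))))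
      }
      where
      rep : Fin (length (sort xs)) → X
      rep = List.lookup (sort xs)
      rank : X → Fin (length (sort xs))
      rank x = Any.index (∈-sort (complete x))
      rep-rank : ∀ x → x ∼ rep (rank x)
      rep-rank x = Any.lookup-index (∈-sort (complete x))
      rep-strict : ∀ {i j} → i Fin.< j → rep i ≺ rep j
      rep-strict = AllPairs-lookup (sort-sorted xs)
      rep-mono : ∀ {i j} → i Fin.≤ j → rep i ≼ rep j
      rep-mono {i} {j} i≤j with Fin.<-cmp i j
      ... | tri< i<j _ _  = ≺⇒≼ (rep-strict i<j)
      ... | tri≈ _ refl _ = ≼-refl
      ... | tri> _ _ j<i  = contradiction i≤j (ℕ.<⇒≱ j<i)
      rep-reflect : ∀ {i j} → rep i ≼ rep j → i Fin.≤ j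
      rep-reflect p = ℕ.≮⇒≥ λ j<i → rep-strict j<i p
      rank-mono : ∀ {x y} → x ≼ y → rank x Fin.≤ rank y
      rank-mono {x} {y} x≼y = rep-reflect (trans′ (proj₂ (rep-rank x)) (trans′ x≼y (proj₁ (rep-rank y))))

module _ {_≼₁_ : Rel X 0ℓ} {_≼₂_ : Rel Y 0ℓ} (R₁ : Ranking _≼₁_) (R₂ : Ranking _≼₂_) where

  private
    module R₁ = Ranking R₁
    module R₂ = Ranking R₂

  rank-map : (X → Y) → Fin R₁.height → Fin R₂.height
  rank-map g i = R₂.rank (g (R₁.rep i))

  rank-map-strictly-monotone : ∀ {g} → (∀ {x y} → g x ≼₂ g y → x ≼₁ y) → StrictlyMonotone (rank-map g)
  rank-map-strictly-monotone {g} reflect {i} {j} i<j = ℕ.≰⇒> λ le →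
    ℕ.<⇒≱ i<j (subst₂ Fin._≤_ (R₁.rank-rep j) (R₁.rank-rep i) (R₁.rank-mono (reflect (R₂.rank-refl le))))

  rank-map-rank : ∀ {g} → (∀ {x y} → x ≼₁ y → g x ≼₂ g y) → ∀ x → rank-map g (R₁.rank x) ≡ R₂.rank (g x)
  rank-map-rank preserve x = Fin.≤-antisym
    (R₂.rank-mono (preserve (R₁.rank-refl (Fin.≤-reflexive (R₁.rank-rep (R₁.rank x))))))
    (R₂.rank-mono (preserve (R₁.rank-refl (Fin.≤-reflexive (sym (R₁.rank-rep (R₁.rank x)))))))

T-⇔⇒≡ : ∀ {x y} → (T x → T y) → (T y → T x) → x ≡ y
T-⇔⇒≡ {false} {false} _ _ = refl
T-⇔⇒≡ {false} {true}  _ g = contradiction (g _) λ ()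
T-⇔⇒≡ {true}  {false} f _ = contradiction (f _) λ ()
T-⇔⇒≡ {true}  {true}  _ _ = refl

module _ {N : ℕ} (D : Fin N → Fin N → ℕ) where

  -- Only the values D u v with u < v matter.
  weight : Fin N → Fin N → ℕ
  weight u v with Fin.<-cmp u v
  ... | tri< _ _ _ = suc (D u v)
  ... | tri≈ _ _ _ = 0
  ... | tri> _ _ _ = suc (D v u)

  weight-diagonal : ∀ u → weight u u ≡ 0
  weight-diagonal u with Fin.<-cmp u u
  ... | tri< _ u≢u _ = contradiction refl u≢u
  ... | tri≈ _ _ _   = refl
  ... | tri> _ u≢u _ = contradiction refl u≢u

  weight-ascending : ∀ {u v} → u Fin.< v → weight u v ≡ suc (D u v)
  weight-ascending {u} {v} u<v with Fin.<-cmp u v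
  ... | tri< _ _ _   = refl
  ... | tri≈ u≮v _ _ = contradiction u<v u≮v
  ... | tri> u≮v _ _ = contradiction u<v u≮v

  weight-descending : ∀ {u v} → v Fin.< u → weight u v ≡ suc (D v u)
  weight-descending {u} {v} v<u with Fin.<-cmp u v
  ... | tri< _ _ v≮u = contradiction v<u v≮u
  ... | tri≈ _ _ v≮u = contradiction v<u v≮u
  ... | tri> _ _ _   = refl

  weight-sym : ∀ u v → weight u v ≡ weight v u
  weight-sym u v = helper (Fin.<-cmp u v)
    where
    helper : _ → weight u v ≡ weight v u
    helper (tri< u<v _ _)  = trans (weight-ascending u<v) (sym (weight-descending u<v))
    helper (tri≈ _ refl _) = refl
    helper (tri> _ _ v<u)  = trans (weight-descending v<u) (sym (weight-ascending v<u))

  -- Off the diagonal `weight` is a successor; this shift separates even the smallest colour from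
  -- the diagonal.
  weight-zero : ∀ u v → weight u v ≤ 0 → u ≡ v
  weight-zero u v w≤0 with Fin.<-cmp u v
  ... | tri≈ _ eq _ = eq

  space : 1 ≤ N → OrdEchSpace
  space 1≤N = record
    { size          = N
    ; ech           = λ x y z w → weight x y ≤ᵇ weight z w
    ; ord           = λ x y → toℕ x ≤ᵇ toℕ y
    ; nonempty      = 1≤N
    ; ech-refl      = λ x y → ℕ.≤⇒≤ᵇ (ℕ.≤-refl {weight x y})
    ; ech-trans     = λ x₁ y₁ x₂ y₂ x₃ y₃ → ≤ᵇ-trans (weight x₁ y₁) (weight x₂ y₂) (weight x₃ y₃)
    ; ech-total     = λ x y z w → total (ℕ.≤-total (weight x y) (weight z w))
    ; ech-diag-min  = λ x y z → ℕ.≤⇒≤ᵇ (subst (_≤ weight y z) (sym (weight-diagonal x)) z≤n)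
    ; ech-diag-only = λ x y z p → weight-zero y z (subst (weight y z ≤_) (weight-diagonal x) (ℕ.≤ᵇ⇒≤ _ _ p))
    ; ech-sym       = λ x y → ℕ.≤⇒≤ᵇ (ℕ.≤-reflexive (weight-sym x y))
    ; ord-refl      = λ x → ℕ.≤⇒≤ᵇ (ℕ.≤-refl {toℕ x})
    ; ord-antisym   = λ x y p q → Fin.≤-antisym (ℕ.≤ᵇ⇒≤ _ _ p) (ℕ.≤ᵇ⇒≤ _ _ q)
    ; ord-trans     = λ x y z → ≤ᵇ-trans (toℕ x) (toℕ y) (toℕ z)
    ; ord-total     = λ x y → total (ℕ.≤-total (toℕ x) (toℕ y))
    }
    where
    ≤ᵇ-trans : ∀ l m n → T (l ≤ᵇ m) → T (m ≤ᵇ n) → T (l ≤ᵇ n)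
    ≤ᵇ-trans l m n p q = ℕ.≤⇒≤ᵇ (ℕ.≤-trans (ℕ.≤ᵇ⇒≤ l m p) (ℕ.≤ᵇ⇒≤ m n q))
    total : ∀ {m n} → m ≤ n ⊎ n ≤ m → T (m ≤ᵇ n) ⊎ T (n ≤ᵇ m)
    total (inj₁ p) = inj₁ (ℕ.≤⇒≤ᵇ p)
    total (inj₂ p) = inj₂ (ℕ.≤⇒≤ᵇ p)

-- Images of maps as subsets, and patterns pulled back along maps

module _ {N : ℕ} (f : Fin n → Fin N) where

  image : Subset N
  image = Vec.tabulate λ v → does (Fin.any? λ i → f i Fin.≟ v)

  ∈-image⁺ : ∀ i → f i Subset.∈ image
  ∈-image⁺ i = Vec.lookup⇒[]= (f i) image (trans (Vec.lookup∘tabulate _ (f i)) found)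
    where
    found : does (Fin.any? λ j → f j Fin.≟ f i) ≡ true
    found with Fin.any? (λ j → f j Fin.≟ f i)
    ... | yes _ = refl
    ... | no ∄j = contradiction (i , refl) ∄j

  ∈-image⁻ : ∀ {v} → v Subset.∈ image → ∃ λ i → f i ≡ v
  ∈-image⁻ {v} v∈ = found (trans (sym (Vec.lookup∘tabulate _ v)) (Vec.[]=⇒lookup v∈))
    where
    found : does (Fin.any? λ i → f i Fin.≟ v) ≡ true → ∃ λ i → f i ≡ v
    found eq with Fin.any? (λ i → f i Fin.≟ v)
    ... | yes p = p

-- Two maps that factor through each other have the same range.
≡-image : ∀ {m N} {S : Subset N} {f : Fin n → Fin N} {g : Fin m → Fin N} →
          (∀ v → (v Subset.∈ S → ∃ λ x → f x ≡ v) × (∀ x → f x ≡ v → v Subset.∈ S)) →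
          (p : Fin n → Fin m) → (∀ x → g (p x) ≡ f x) →
          (r : Fin m → Fin n) → (∀ u → g u ≡ f (r u)) → S ≡ image g
≡-image {S = S} {f} {g} f-image p gp≗f r g≗fr = Subset.⊆-antisym S⊆ ⊆S
  where
  S⊆ : S Subset.⊆ image g
  S⊆ {v} v∈S with proj₁ (f-image v) v∈S
  ... | x , refl = subst (Subset._∈ image g) (gp≗f x) (∈-image⁺ g (p x))
  ⊆S : image g Subset.⊆ S
  ⊆S {v} v∈ with ∈-image⁻ g v∈
  ... | u , refl = proj₂ (f-image (g u)) (r u) (sym (g≗fr u))

-- Off the image of m the pattern takes junk values.
pullback : ∀ {a q} → (Fin a → Fin q) → (Fin a → Fin a → Fin q) → Pattern q
pullback m t j j′ with Fin.any? (λ i → m i Fin.≟ j) | Fin.any? (λ i → m i Fin.≟ j′)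
... | yes (i , _) | yes (i′ , _) = t i i′
... | _           | _            = j

pullback-≡ : ∀ {a q} {m : Fin a → Fin q} → Injective _≡_ _≡_ m → ∀ t i i′ →
             pullback m t (m i) (m i′) ≡ t i i′
pullback-≡ {m = m} inj t i i′ with Fin.any? (λ l → m l Fin.≟ m i) | Fin.any? (λ l → m l Fin.≟ m i′)
... | yes (_ , eq) | yes (_ , eq′) = cong₂ t (inj eq) (inj eq′)
... | yes _        | no ∄          = contradiction (i′ , refl) ∄
... | no ∄         | _             = contradiction (i , refl) ∄

-- Copies in a partite system

module Ranks (A : OrdEchSpace) where

  _≼ᵖ_ : Rel (Fin (size A)) 0ℓ
  x ≼ᵖ y = T (ord A x y)

  _≼ᵉ_ : Rel (Fin (size A) × Fin (size A)) 0ℓ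
  (x , y) ≼ᵉ (z , w) = T (ech A x y z w)

  points : Ranking _≼ᵖ_
  points = ranking _≼ᵖ_ (λ x y → T? (ord A x y)) (ord-total A) (λ {x} {y} {z} → ord-trans A x y z)
                   (List.allFin (size A)) List.∈-allFin

  pairs : Ranking _≼ᵉ_
  pairs = ranking _≼ᵉ_ (λ { (x , y) (z , w) → T? (ech A x y z w) })
                  (λ { (x , y) (z , w) → ech-total A x y z w })
                  (λ { {x , y} {z , w} {u , v} → ech-trans A x y z w u v })
                  (List.cartesianProduct (List.allFin (size A)) (List.allFin (size A)))
                  (λ { (x , y) → List.∈-cartesianProduct⁺ (List.∈-allFin x) (List.∈-allFin y) })

  open Ranking points public using () renaming (height to width; rep to point; rank to position)
  open Ranking pairs public using (height) renaming (rank to distance)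

  -- Antisymmetry of the linear order makes its classes singletons.
  point-position : ∀ x → point (position x) ≡ x
  point-position x = ord-antisym A _ _
    (Ranking.rank-refl points (Fin.≤-reflexive (Ranking.rank-rep points (position x))))
    (Ranking.rank-refl points (Fin.≤-reflexive (sym (Ranking.rank-rep points (position x)))))

  position-injective : ∀ {x y} → position x ≡ position y → x ≡ y
  position-injective {x} {y} eq =
    trans (sym (point-position x)) (trans (cong point eq) (point-position y))

  distance-sym : ∀ x y → distance (x , y) ≡ distance (y , x)
  distance-sym x y = Fin.≤-antisym (Ranking.rank-mono pairs (ech-sym A x y))
                                   (Ranking.rank-mono pairs (ech-sym A y x))

  pattern-of : ∀ {q} → (Fin width → Fin q) → (Fin height → Fin q) → Pattern q
  pattern-of s t = pullback s λ i i′ → t (distance (point i , point i′))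

  pattern-of-≡ : ∀ {q} {s : Fin width → Fin q} → Injective _≡_ _≡_ s → ∀ t i i′ →
                 pattern-of s t (s i) (s i′) ≡ t (distance (point i , point i′))
  pattern-of-≡ {s = s} inj t i i′ = pullback-≡ {m = s} inj (λ i i′ → t (distance (point i , point i′))) i i′

module Realisation {q : ℕ} (P : Partite q) where

  private
    s : ℕ
    s = partSize P

  -- The numbering by `combine` lists the parts one after another, so vertices of different parts
  -- are ordered as their parts are.
  partiteDistance : Fin (q * s) → Fin (q * s) → ℕ
  partiteDistance u v =
    let j , x = remQuot s u ; j′ , y = remQuot s v in toℕ (edge P j j′ x y)

  wt : Fin (q * s) → Fin (q * s) → ℕ
  wt = weight partiteDistance

  module _ (B : OrdEchSpace) where

    open Ranks B

    module _
      (σ : Fin width → Fin q) (θ : Fin height → Fin q)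
      (σ↗ : StrictlyMonotone σ) (θ↗ : StrictlyMonotone θ)
      (x : Fin q → Fin s)
      (realises : ∀ j j′ → edge P j j′ (x j) (x j′) ≡ pattern-of σ θ j j′)
      where

      vertex : Fin (size B) → Fin (q * s)
      vertex y = combine (σ (position y)) (x (σ (position y)))

      vertex-injective : Injective _≡_ _≡_ vertex
      vertex-injective eq = position-injective
        (strictly-monotone⇒injective σ↗ (Fin.combine-injectiveˡ _ _ _ _ eq))

      vertex-< : ∀ {y z} → position y Fin.< position z → vertex y Fin.< vertex z
      vertex-< y<z = Fin.combine-monoˡ-< _ _ (σ↗ y<z)

      vertex-ord : ∀ y z → ord B y z ≡ (toℕ (vertex y) ≤ᵇ toℕ (vertex z))
      vertex-ord y z = T-⇔⇒≡ (ℕ.≤⇒≤ᵇ ∘ preserve) (reflect ∘ ℕ.≤ᵇ⇒≤ _ _)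
        where
        preserve : T (ord B y z) → vertex y Fin.≤ vertex z
        preserve y≼z with Fin.<-cmp (position y) (position z)
        ... | tri< y<z _ _ = ℕ.<⇒≤ (vertex-< y<z)
        ... | tri≈ _ eq _  = ℕ.≤-reflexive (cong (toℕ ∘ vertex) (position-injective eq))
        ... | tri> _ _ z<y = contradiction (Ranking.rank-mono points y≼z) (ℕ.<⇒≱ z<y)
        reflect : vertex y Fin.≤ vertex z → T (ord B y z)
        reflect le = Ranking.rank-refl points (ℕ.≮⇒≥ λ z<y → ℕ.<⇒≱ (vertex-< z<y) le)

      vertex-distance : ∀ y z → partiteDistance (vertex y) (vertex z) ≡ toℕ (θ (distance (y , z)))
      vertex-distance y z = begin
        partiteDistance (vertex y) (vertex z)
          ≡⟨ cong₂ (λ { (j , u) (j′ , v) → toℕ (edge P j j′ u v) })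
                   (Fin.remQuot-combine j (x j)) (Fin.remQuot-combine j′ (x j′)) ⟩
        toℕ (edge P j j′ (x j) (x j′))
          ≡⟨ cong toℕ (realises j j′) ⟩
        toℕ (pattern-of σ θ j j′)
          ≡⟨ cong toℕ (pattern-of-≡ (strictly-monotone⇒injective σ↗) θ (position y) (position z)) ⟩
        toℕ (θ (distance (point (position y) , point (position z))))
          ≡⟨ cong₂ (λ y z → toℕ (θ (distance (y , z)))) (point-position y) (point-position z) ⟩
        toℕ (θ (distance (y , z)))
          ∎
        where
        open ≡-Reasoning
        j  = σ (position y)
        j′ = σ (position z)

      -- The diagonal is set apart because its weight is 0, not a shifted colour. A descending pair
      -- is read backwards, which `distance-sym` allows.
      vertex-weight : ∀ y z → y ≡ z ⊎ wt (vertex y) (vertex z) ≡ suc (toℕ (θ (distance (y , z))))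
      vertex-weight y z with Fin.<-cmp (position y) (position z)
      ... | tri< y<z _ _ = inj₂ (trans (weight-ascending _ (vertex-< y<z)) (cong suc (vertex-distance y z)))
      ... | tri≈ _ eq _  = inj₁ (position-injective eq)
      ... | tri> _ _ z<y = inj₂ (trans (weight-descending _ (vertex-< z<y)) (cong suc
          (trans (vertex-distance z y) (cong (toℕ ∘ θ) (distance-sym z y)))))

      vertex-ech : ∀ a b c d → ech B a b c d ≡ (wt (vertex a) (vertex b) ≤ᵇ wt (vertex c) (vertex d))
      vertex-ech a b c d = T-⇔⇒≡ (ℕ.≤⇒≤ᵇ ∘ preserve) (reflect ∘ ℕ.≤ᵇ⇒≤ _ _)
        where
        preserve : T (ech B a b c d) → wt (vertex a) (vertex b) ≤ wt (vertex c) (vertex d)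
        preserve le with vertex-weight a b | vertex-weight c d
        ... | inj₁ refl | _         = subst (_≤ _) (sym (weight-diagonal _ (vertex a))) z≤n
        -- A pair below a diagonal pair is itself diagonal, so the left weight is 0.
        ... | inj₂ eq   | inj₁ refl =
          subst (λ b → wt (vertex a) (vertex b) ≤ wt (vertex c) (vertex c)) (ech-diag-only B c a b le)
            (subst (_≤ _) (sym (weight-diagonal _ (vertex a))) z≤n)
        ... | inj₂ eq   | inj₂ eq′  =
          subst₂ _≤_ (sym eq) (sym eq′) (s≤s (strictly-monotone⇒monotone θ↗ (Ranking.rank-mono pairs le)))
        reflect : wt (vertex a) (vertex b) ≤ wt (vertex c) (vertex d) → T (ech B a b c d)
        reflect le with vertex-weight a b | vertex-weight c d
        ... | inj₁ refl | _         = ech-diag-min B a c d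
        ... | inj₂ eq   | inj₁ refl =
          contradiction (subst₂ _≤_ eq (weight-diagonal _ (vertex c)) le) λ ()
        ... | inj₂ eq   | inj₂ eq′  = Ranking.rank-refl pairs
          (ℕ.≮⇒≥ λ lt → ℕ.<⇒≱ (θ↗ lt) (ℕ.s≤s⁻¹ (subst₂ _≤_ eq eq′ le)))

      image-isCopy : ∀ 1≤ → IsCopy B (space partiteDistance 1≤) (image vertex)
      image-isCopy _ = vertex , vertex-injective ,
        (λ v → ∈-image⁻ vertex , λ { y refl → ∈-image⁺ vertex y }) , vertex-ech , vertex-ord

-- Copies of A inside a copy of B

module _ (A B : OrdEchSpace) {C : OrdEchSpace} {S B̃ : Subset (size C)} (S⊆B̃ : S Subset.⊆ B̃)
  (copyA : IsCopy A C S) (copyB : IsCopy B C B̃) where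

  private
    f  = proj₁ copyA
    g  = proj₁ copyB

  factor : ∀ x → ∃ λ y → g y ≡ f x
  factor x = proj₁ (proj₁ (proj₂ (proj₂ copyB)) (f x))
    (S⊆B̃ (proj₂ (proj₁ (proj₂ (proj₂ copyA)) (f x)) x refl))

  factor-ech : ∀ a b c d → ech A a b c d ≡
    ech B (proj₁ (factor a)) (proj₁ (factor b)) (proj₁ (factor c)) (proj₁ (factor d))
  factor-ech a b c d with factor a | factor b | factor c | factor d
  ... | a′ , p | b′ , q | c′ , r | d′ , s = begin
    ech A a b c d                       ≡⟨ proj₁ (proj₂ (proj₂ (proj₂ copyA))) a b c d ⟩
    ech C (f a) (f b) (f c) (f d)       ≡⟨ cong₂ (λ u v → ech C u v (f c) (f d)) p q ⟨
    ech C (g a′) (g b′) (f c) (f d)     ≡⟨ cong₂ (ech C (g a′) (g b′)) r s ⟨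
    ech C (g a′) (g b′) (g c′) (g d′)   ≡⟨ proj₁ (proj₂ (proj₂ (proj₂ copyB))) a′ b′ c′ d′ ⟨
    ech B a′ b′ c′ d′                   ∎
    where open ≡-Reasoning

  factor-ord : ∀ a b → ord A a b ≡ ord B (proj₁ (factor a)) (proj₁ (factor b))
  factor-ord a b with factor a | factor b
  ... | a′ , p | b′ , q = trans (proj₂ (proj₂ (proj₂ (proj₂ copyA))) a b)
    (trans (sym (cong₂ (ord C) p q)) (sym (proj₂ (proj₂ (proj₂ (proj₂ copyB))) a′ b′)))

-- The space C and the monochromatic copy of B

module Assembly (A B : OrdEchSpace) (k : ℕ) where

  private
    module A = Ranks A
    module B = Ranks B

  q : ℕ
  q = proj₁ (product-ramsey A.width A.height B.width B.height k)

  -- Vectors rather than increasing maps, so that `copies` can list them all; the list includes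
  -- vectors that are not increasing.
  Copy : Set
  Copy = Vec (Fin q) A.width × Vec (Fin q) A.height

  parts : Copy → Fin A.width → Fin q
  parts (p , _) = Vec.lookup p

  copyPattern : Copy → Pattern q
  copyPattern (p , t) = A.pattern-of (Vec.lookup p) (Vec.lookup t)

  copies : List Copy
  copies = List.cartesianProduct (words (List.allFin q) A.width) (words (List.allFin q) A.height)

  ∈-copies : ∀ c → c ∈ copies
  ∈-copies (p , t) = List.∈-cartesianProduct⁺ (∈-words-allFin p) (∈-words-allFin t)

  P : Partite q
  P = proj₁ (partite-ramsey {k = k} parts copyPattern copies)

  s : ℕ
  s = partSize P

  open Realisation P

  N : ℕ
  N = q * s

  copySet : Copy → Vec (Fin s) A.width → Subset N
  copySet c x = image λ u → combine (parts c u) (Vec.lookup x u)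

  C : 1 ≤ N → OrdEchSpace
  C = space partiteDistance

  module _ (χ : Subset N → Fin k) where

    partite = proj₂ (partite-ramsey {k = k} parts copyPattern copies) (λ c x → χ (copySet c x))

    place : Pattern q → Fin q → Fin s
    place = proj₁ partite

    copyColour : Copy → Fin k
    copyColour c = proj₁ (proj₂ (proj₂ partite) (∈-copies c))

    copyColour-≡ : ∀ c τ → (∀ u v → τ (parts c u) (parts c v) ≡ copyPattern c (parts c u) (parts c v)) →
                   χ (copySet c (restrict (parts c) (place τ))) ≡ copyColour c
    copyColour-≡ c = proj₂ (proj₂ (proj₂ partite) (∈-copies c))

    homogeneous = proj₂ (product-ramsey A.width A.height B.width B.height k)
                        (λ p t → copyColour (p , t))

    σ : Fin B.width → Fin q
    σ = proj₁ homogeneous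

    θ : Fin B.height → Fin q
    θ = proj₁ (proj₂ homogeneous)

    σ↗ : StrictlyMonotone σ
    σ↗ = proj₁ (proj₂ (proj₂ homogeneous))

    θ↗ : StrictlyMonotone θ
    θ↗ = proj₁ (proj₂ (proj₂ (proj₂ homogeneous)))

    colour : Fin k
    colour = proj₁ (proj₂ (proj₂ (proj₂ (proj₂ homogeneous))))

    colour-≡ : ∀ f g → StrictlyMonotone f → StrictlyMonotone g →
               copyColour (Vec.tabulate (σ ∘ f) , Vec.tabulate (θ ∘ g)) ≡ colour
    colour-≡ = proj₂ (proj₂ (proj₂ (proj₂ (proj₂ homogeneous))))

    -- The maps σ and θ are known only after χ has been made to depend on patterns; `place` covers
    -- every pattern, hence also this one.
    τ : Pattern q
    τ = B.pattern-of σ θ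

    realises : ∀ j j′ → edge P j j′ (place τ j) (place τ j′) ≡ τ j j′
    realises = proj₁ (proj₂ partite) τ

    inB : Fin (size B) → Fin N
    inB = vertex B σ θ σ↗ θ↗ (place τ) realises

    B̃ : Subset N
    B̃ = image inB

    module _ (1≤N : 1 ≤ N) where

      copyB : IsCopy B (C 1≤N) B̃
      copyB = image-isCopy B σ θ σ↗ θ↗ (place τ) realises 1≤N

      module _ (S : Subset N) (S⊆B̃ : S Subset.⊆ B̃) (copyA : IsCopy A (C 1≤N) S) where

        f : Fin (size A) → Fin N
        f = proj₁ copyA

        f-image : ∀ v → (v Subset.∈ S → ∃ λ x → f x ≡ v) × (∀ x → f x ≡ v → v Subset.∈ S)
        f-image = proj₁ (proj₂ (proj₂ copyA))

        φ : Fin (size A) → Fin (size B)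
        φ x = proj₁ (factor A B {C 1≤N} S⊆B̃ copyA copyB x)

        inB-φ : ∀ x → inB (φ x) ≡ f x
        inB-φ x = proj₂ (factor A B {C 1≤N} S⊆B̃ copyA copyB x)

        φ² : Fin (size A) × Fin (size A) → Fin (size B) × Fin (size B)
        φ² (x , y) = φ x , φ y

        φ-ech : ∀ a b c d → ech A a b c d ≡ ech B (φ a) (φ b) (φ c) (φ d)
        φ-ech = factor-ech A B {C 1≤N} S⊆B̃ copyA copyB

        φ-ord : ∀ a b → ord A a b ≡ ord B (φ a) (φ b)
        φ-ord = factor-ord A B {C 1≤N} S⊆B̃ copyA copyB

        e : Fin A.width → Fin B.width
        e = rank-map A.points B.points φ

        e↗ : StrictlyMonotone e
        e↗ = rank-map-strictly-monotone A.points B.points λ {x} {y} → subst T (sym (φ-ord x y))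

        d : Fin A.height → Fin B.height
        d = rank-map A.pairs B.pairs φ²

        d↗ : StrictlyMonotone d
        d↗ = rank-map-strictly-monotone A.pairs B.pairs
               λ { {x , y} {z , w} → subst T (sym (φ-ech x y z w)) }

        d-distance : ∀ xy → d (A.distance xy) ≡ B.distance (φ² xy)
        d-distance = rank-map-rank A.pairs B.pairs λ { {x , y} {z , w} → subst T (φ-ech x y z w) }

        c : Copy
        c = Vec.tabulate (σ ∘ e) , Vec.tabulate (θ ∘ d)

        parts-c : ∀ u → parts c u ≡ σ (e u)
        parts-c = Vec.lookup∘tabulate (σ ∘ e)

        -- Both sides are the θ-colour of the same distance class of B: on the left it is computed
        -- from points of B, on the right it is the image under d of a distance in A.
        agree : ∀ u v → τ (parts c u) (parts c v) ≡ copyPattern c (parts c u) (parts c v)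
        agree u v = begin
          τ (parts c u) (parts c v)
            ≡⟨ cong₂ τ (parts-c u) (parts-c v) ⟩
          τ (σ (e u)) (σ (e v))
            ≡⟨ B.pattern-of-≡ {s = σ} (strictly-monotone⇒injective σ↗) θ (e u) (e v) ⟩
          θ (B.distance (B.point (e u) , B.point (e v)))
            ≡⟨ cong₂ (λ x y → θ (B.distance (x , y)))
                     (B.point-position (φ (A.point u))) (B.point-position (φ (A.point v))) ⟩
          θ (B.distance (φ (A.point u) , φ (A.point v)))
            ≡⟨ cong θ (d-distance (A.point u , A.point v)) ⟨
          θ (d (A.distance (A.point u , A.point v)))
            ≡⟨ Vec.lookup∘tabulate (θ ∘ d) (A.distance (A.point u , A.point v)) ⟨
          Vec.lookup (proj₂ c) (A.distance (A.point u , A.point v))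
            ≡⟨ A.pattern-of-≡ {s = parts c} parts-injective (Vec.lookup (proj₂ c)) u v ⟨
          copyPattern c (parts c u) (parts c v)
            ∎
          where
          open ≡-Reasoning
          parts-injective : Injective _≡_ _≡_ (parts c)
          parts-injective {u} {v} eq = strictly-monotone⇒injective e↗
            (strictly-monotone⇒injective σ↗ (trans (sym (parts-c u)) (trans eq (parts-c v))))

        copyVertex : Fin A.width → Fin N
        copyVertex u = combine (parts c u) (Vec.lookup (restrict (parts c) (place τ)) u)

        copyVertex-≡ : ∀ u → copyVertex u ≡ f (A.point u)
        copyVertex-≡ u = trans
          (cong₂ combine (parts-c u)
            (trans (Vec.lookup∘tabulate (place τ ∘ parts c) u) (cong (place τ) (parts-c u))))
          (inB-φ (A.point u))

        S≡copySet : S ≡ copySet c (restrict (parts c) (place τ))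
        S≡copySet = ≡-image f-image
          A.position (λ x → trans (copyVertex-≡ (A.position x)) (cong f (A.point-position x)))
          A.point copyVertex-≡

        -- Two homogeneities combine: the partite system makes χ S depend on c only, and the product
        -- form of Ramsey's theorem gives every c that factors through σ and θ by increasing maps
        -- the same colour.
        monochromatic : χ S ≡ colour
        monochromatic = trans (cong χ S≡copySet) (trans (copyColour-≡ c τ agree) (colour-≡ e d e↗ d↗))

theorem4p6 : IsRamseyClassOES
theorem4p6 A B k 1≤k = C 1≤N , λ χ →
  B̃ χ , copyB χ 1≤N , colour χ , monochromatic χ 1≤N
  where
  open Assembly A B k
  someColour : Fin k
  someColour = Fin.fromℕ< 1≤k
  -- The copy of B exists for any colouring, which shows that C is non-empty.
  1≤N : 1 ≤ N
  1≤N = ℕ.>-nonZero⁻¹ N {{Fin.nonZeroIndex (inB (λ _ → someColour) (Fin.fromℕ< (nonempty B)))}}
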